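{- For every $\xi>0$ there is $m_0$ such that for every $m\ge m_0$ the following holds: every $m$-partite graph $G$ with nonempty vertex classes $V_1,\dots,V_m$ such that for all $1\le i<j\le m$ the bipartite graph $G[V_i,V_j]$, with ordered bipartition $(V_i,V_j)$, is $\xi$-rich, contains a triangle.
   Context: Let $\xi>0$ and let $G$ be a bipartite graph with fixed ordered bipartition $(X,Y)$. For $y\in Y$, the number of two-edge walks starting at $y$ is $\sum_{x\in N(y)}\deg(x)$ (walks $yxy'$ with $xy,xy'\in E(G)$, allowing $y'=y$). $G$ is $\xi$-poor if there are at most $\xi|Y|$ vertices $y\in Y$ for which the number of two-edge walks starting at $y$ is larger than $(\frac14+\xi)|X||Y|$; otherwise $G$ is $\xi$-rich. -}

module Defs where

open import Data.Nat as ℕ using (ℕ; zero; suc)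
open import Data.Fin using (Fin; zero; suc)
open import Data.Bool using (Bool; true; false; if_then_else_)
open import Data.Integer using (+_)
open import Data.Rational using (ℚ; _/_; _+_; _*_; _<_)
open import Data.Rational.Properties using (_<?_)
open import Data.Product using (Σ; _×_; ∃-syntax)
open import Relation.Nullary using (does)
open import Relation.Binary.PropositionalEquality using (_≡_)

∑ : (n : ℕ) → (Fin n → ℕ) → ℕ
∑ zero f = 0
∑ (suc n) f = f zero ℕ.+ ∑ n (λ i → f (suc i))

count : (n : ℕ) → (Fin n → Bool) → ℕ
count n p = ∑ n (λ i → if p i then 1 else 0)

ℕ→ℚ : ℕ → ℚ
ℕ→ℚ k = + k / 1

¼ : ℚ
¼ = + 1 / 4

-- Bipartite graphs with fixed ordered bipartition (X , Y), |X| = a, |Y| = b,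
-- given by an adjacency relation  e x y  (x ∈ X, y ∈ Y).

degX : (a b : ℕ) → (Fin a → Fin b → Bool) → Fin a → ℕ
degX a b e x = count b (λ y → e x y)

-- number of two-edge walks y x y' starting at y ∈ Y:  Σ_{x ∈ N(y)} deg(x)
walks2 : (a b : ℕ) → (Fin a → Fin b → Bool) → Fin b → ℕ
walks2 a b e y = ∑ a (λ x → if e x y then degX a b e x else 0)

heavy : (ξ : ℚ) (a b : ℕ) → (Fin a → Fin b → Bool) → Fin b → Bool
heavy ξ a b e y = does (((¼ + ξ) * ℕ→ℚ a) * ℕ→ℚ b <? ℕ→ℚ (walks2 a b e y))

Poor : (ξ : ℚ) (a b : ℕ) → (Fin a → Fin b → Bool) → Set
Poor ξ a b e = Data.Rational._≤_ (ℕ→ℚ (count b (heavy ξ a b e))) (ξ * ℕ→ℚ b)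

Rich : (ξ : ℚ) (a b : ℕ) → (Fin a → Fin b → Bool) → Set
Rich ξ a b e = ξ * ℕ→ℚ b < ℕ→ℚ (count b (heavy ξ a b e))

-- m-partite graphs with vertex classes V_i of sizes n i.
-- A vertex is a pair (i , v) with v : Fin (n i); adjacency is given by adj.
record MPartiteGraph (m : ℕ) (n : Fin m → ℕ) : Set where
  field
    adj   : (i : Fin m) → Fin (n i) → (j : Fin m) → Fin (n j) → Bool
    sym   : ∀ i u j v → adj i u j v ≡ adj j v i u
    indep : ∀ i u v → adj i u i v ≡ false

open MPartiteGraph public

bip : ∀ {m n} → MPartiteGraph m n → (i j : Fin m) → Fin (n i) → Fin (n j) → Bool
bip G i j u v = adj G i u j v

-- G contains a triangle: three pairwise adjacent vertices
-- (they automatically lie in three distinct classes, hence are distinct)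
HasTriangle : ∀ {m n} → MPartiteGraph m n → Set
HasTriangle {m} {n} G =
  ∃[ i ] ∃[ u ] ∃[ j ] ∃[ v ] ∃[ k ] Σ (Fin (n k)) λ w →
    (adj G i u j v ≡ true) × (adj G j v k w ≡ true) × (adj G i u k w ≡ true)

{-# OPTIONS --safe #-}
module Submission where

-- Write q for the denominator of ξ, so ξ ≥ 1/q, and put N = 2q.  Averaging over the pairs (y , c)
-- gives, for the largest class k of any long list of classes, a vertex y of V_k and a level c such
-- that for a constant fraction of the classes i in the list y is heavy towards V_i and |N_i(y)| / |V_i|
-- lies in [c/N , (c+1)/N].  Iterating inside those classes produces a chain of picks (k , y , c), each
-- good towards all later picked classes, and a class V_i towards which all of them are good.
--
-- For each pick let D be the set of x ∈ N_i(y) with deg_k(x) > (1 − c/N) |V_k|.  As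
-- (c+1)/N · (1 − c/N) ≤ 1/4 + 1/N, heaviness forces |D| > |V_i| / N.  After N (N + 1) picks, two of
-- them, (k , y , c) and (j , y′ , c) with j < k, have equal level and a common x ∈ D.  Then x is
-- adjacent to y, x sees more than a 1 − c/N fraction of V_j and y at least c/N of it, so x and y have
-- a common neighbour in V_j.

open import Defs hiding (sym)
open import Data.Nat using (ℕ; _≤_; NonZero)
open import Data.Fin using (Fin; _<_)
open import Data.Rational using (ℚ; 0ℚ) renaming (_<_ to _<ℚ_)
open import Data.Product using (∃-syntax)

open import Data.Nat using (zero; suc; _+_; _*_; _/_; _<?_; _≤?_; z≤n; s≤s) renaming (_<_ to _<ℕ_)
open import Data.Nat.Properties
open import Data.Nat.DivMod using (m/n*n≤m; m%n<n; m≡m%n+[m/n]*n; m<n*o⇒m/o<n)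
open import Data.Nat.Tactic.RingSolver using (solve-∀)
open import Data.Integer using (+_; +[1+_]; -[1+_]; +<+) renaming (_*_ to _*ℤ_; _<_ to _<ℤ_)
import Data.Integer.Properties as ℤ
open import Data.Rational using (mkℚ; toℚᵘ; ↧ₙ_; *<*) renaming (_*_ to _*ℚ_; _+_ to _+ℚ_)
import Data.Rational.Properties as ℚ
open import Data.Rational.Unnormalised using (mkℚᵘ; _≃_; *≡*)
import Data.Rational.Unnormalised.Properties as ℚᵘ
open import Data.Fin using (toℕ; fromℕ<; opposite; zero; suc)
open import Data.Fin.Properties using (toℕ<n; toℕ-fromℕ<; opposite-prop) renaming (_≟_ to _≟F_)
open import Data.Bool using (Bool; true; false; if_then_else_; _∧_)
import Data.Bool.Properties as Bool
open import Data.List using ([]; _∷_; length; filter; tabulate)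
open import Data.List.Properties using (length-tabulate)
open import Data.List.Relation.Unary.All as All using (All; []; _∷_)
import Data.List.Relation.Unary.All.Properties as All
open import Data.List.Relation.Unary.AllPairs using (AllPairs; []; _∷_)
import Data.List.Relation.Unary.AllPairs.Properties as AllPairs
open import Data.Product using (_×_; _,_; proj₁; proj₂)
open import Data.Sum using (inj₁; inj₂)
open import Data.Unit using (⊤)
open import Function using (_∘_)
open import Relation.Nullary using (Dec; yes; no; does)
open import Relation.Nullary.Decidable using (_×-dec_; dec-true)
open import Relation.Binary.PropositionalEquality using (_≡_; refl; sym; trans; cong; cong₂; subst; subst₂)

-- Clearing denominators

toℚᵘ-ℕ→ℚ : ∀ k → toℚᵘ (ℕ→ℚ k) ≃ mkℚᵘ (+ k) 0
toℚᵘ-ℕ→ℚ k = ℚ.toℚᵘ-fromℚᵘ (mkℚᵘ (+ k) 0)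

-- Working with unnormalised representatives keeps gcds out: the denominator `suc d` survives
-- multiplication by a natural number.
toℚᵘ-*-ℕ→ℚ : ∀ {r m d} k → toℚᵘ r ≃ mkℚᵘ (+ m) d → toℚᵘ (r *ℚ ℕ→ℚ k) ≃ mkℚᵘ (+ (m * k)) d
toℚᵘ-*-ℕ→ℚ {r} {m} {d} k r≃m/d =
  ℚᵘ.≃-trans (ℚ.toℚᵘ-homo-* r (ℕ→ℚ k))
    (ℚᵘ.≃-trans (ℚᵘ.*-cong r≃m/d (toℚᵘ-ℕ→ℚ k))
      (*≡* (cong₂ _*ℤ_ (sym (ℤ.pos-* m k)) (cong +[1+_] (sym (*-identityʳ d))))))

<-ℕ→ℚ⇒< : ∀ {r m d} k → toℚᵘ r ≃ mkℚᵘ (+ m) d → r <ℚ ℕ→ℚ k → m <ℕ k * suc d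
<-ℕ→ℚ⇒< {r} {m} {d} k r≃m/d r<k = ℤ.drop‿+<+
  (subst₂ _<ℤ_ (ℤ.*-identityʳ (+ m)) (sym (ℤ.pos-* k (suc d)))
    (ℚᵘ.drop-*<* (ℚᵘ.<-respˡ-≃ r≃m/d (ℚᵘ.<-respʳ-≃ (toℚᵘ-ℕ→ℚ k) (ℚ.toℚᵘ-mono-< r<k)))))

positive-numerator : ∀ ξ → 0ℚ <ℚ ξ → ∃[ p ] toℚᵘ ξ ≃ mkℚᵘ +[1+ p ] (Data.Rational.ℚ.denominator-1 ξ)
positive-numerator (mkℚ +[1+ p ] d _) _ = p , ℚᵘ.≃-refl
positive-numerator (mkℚ (+ zero) d _) (*<* (+<+ ()))
positive-numerator (mkℚ -[1+ p ] d _) (*<* ())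

-- A positive numerator is at least 1, so `r` can be weakened to 1 / `suc d`.
clear-Rich : ∀ r p d b h → toℚᵘ r ≃ mkℚᵘ +[1+ p ] d → r *ℚ ℕ→ℚ b <ℚ ℕ→ℚ h → b <ℕ suc d * h
clear-Rich r p d b h r≃ lt = begin-strict
  b          ≤⟨ m≤m+n b (p * b) ⟩
  suc p * b  <⟨ <-ℕ→ℚ⇒< {r *ℚ ℕ→ℚ b} {suc p * b} {d} h (toℚᵘ-*-ℕ→ℚ {r} {suc p} {d} b r≃) lt ⟩
  h * suc d  ≡⟨ *-comm h (suc d) ⟩
  suc d * h  ∎
  where open ≤-Reasoning

clear-heavy : ∀ r p d a b w → toℚᵘ r ≃ mkℚᵘ +[1+ p ] d →
  ((¼ +ℚ r) *ℚ ℕ→ℚ a) *ℚ ℕ→ℚ b <ℚ ℕ→ℚ w → (suc d + 4) * (a * b) <ℕ 4 * suc d * w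
clear-heavy r p d a b w r≃ lt = begin-strict
  (q + 4) * (a * b)              ≤⟨ *-monoˡ-≤ (a * b) (+-mono-≤ (≤-reflexive (sym (*-identityˡ q))) (m≤m+n 4 (p * 4))) ⟩
  (1 * q + suc p * 4) * (a * b)  ≡⟨ *-assoc (1 * q + suc p * 4) a b ⟨
  -- Here `d + 3 * q` is the predecessor of `4 * q`, the common denominator of `¼` and `r`.
  (1 * q + suc p * 4) * a * b    <⟨ <-ℕ→ℚ⇒< {t} {(1 * q + suc p * 4) * a * b} {d + 3 * q} w t≃ lt ⟩
  w * (4 * q)                    ≡⟨ *-comm w (4 * q) ⟩
  4 * q * w                      ∎
  where
  open ≤-Reasoning
  q = suc d
  t = ((¼ +ℚ r) *ℚ ℕ→ℚ a) *ℚ ℕ→ℚ b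
  t≃ : toℚᵘ t ≃ mkℚᵘ (+ ((1 * q + suc p * 4) * a * b)) (d + 3 * q)
  t≃ = toℚᵘ-*-ℕ→ℚ {(¼ +ℚ r) *ℚ ℕ→ℚ a} b (toℚᵘ-*-ℕ→ℚ {¼ +ℚ r} {1 * q + suc p * 4} {d + 3 * q} a
    (ℚᵘ.≃-trans (ℚ.toℚᵘ-homo-+ ¼ r) (ℚᵘ.+-congʳ (toℚᵘ ¼) r≃)))

Rich⇒count : ∀ ξ → 0ℚ <ℚ ξ → ∀ a b e → Rich ξ a b e → b <ℕ ↧ₙ ξ * count b (heavy ξ a b e)
Rich⇒count ξ ξ>0 a b e = clear-Rich ξ (proj₁ p) (Data.Rational.ℚ.denominator-1 ξ) b (count b (heavy ξ a b e)) (proj₂ p)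
  where p = positive-numerator ξ ξ>0

does-true : ∀ {A : Set} (a? : Dec A) → does a? ≡ true → A
does-true (yes a) refl = a

heavy⇒walks2 : ∀ ξ → 0ℚ <ℚ ξ → ∀ a b e y → heavy ξ a b e y ≡ true →
  (↧ₙ ξ + 4) * (a * b) <ℕ 4 * ↧ₙ ξ * walks2 a b e y
heavy⇒walks2 ξ ξ>0 a b e y hv =
  clear-heavy ξ (proj₁ p) (Data.Rational.ℚ.denominator-1 ξ) a b w (proj₂ p)
    (does-true (((¼ +ℚ ξ) *ℚ ℕ→ℚ a) *ℚ ℕ→ℚ b ℚ.<? ℕ→ℚ w) hv)
  where
  p = positive-numerator ξ ξ>0
  w = walks2 a b e y

-- Finite sums and averaging

𝟙 : Bool → ℕ
𝟙 b = if b then 1 else 0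

∑-mono : ∀ n {f g : Fin n → ℕ} → (∀ i → f i ≤ g i) → ∑ n f ≤ ∑ n g
∑-mono zero    f≤g = z≤n
∑-mono (suc n) f≤g = +-mono-≤ (f≤g zero) (∑-mono n (f≤g ∘ suc))

∑-+ : ∀ n (f g : Fin n → ℕ) → ∑ n (λ i → f i + g i) ≡ ∑ n f + ∑ n g
∑-+ zero    f g = refl
∑-+ (suc n) f g rewrite ∑-+ n (f ∘ suc) (g ∘ suc) =
  interchange (f zero) (g zero) (∑ n (f ∘ suc)) (∑ n (g ∘ suc))
  where
  interchange : ∀ a b c d → a + b + (c + d) ≡ a + c + (b + d)
  interchange = solve-∀

∑-* : ∀ n k (f : Fin n → ℕ) → ∑ n (λ i → k * f i) ≡ k * ∑ n f
∑-* zero    k f = sym (*-zeroʳ k)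
∑-* (suc n) k f rewrite ∑-* n k (f ∘ suc) = sym (*-distribˡ-+ k (f zero) _)

∑-cong : ∀ n {f g : Fin n → ℕ} → (∀ i → f i ≡ g i) → ∑ n f ≡ ∑ n g
∑-cong zero    f≡g = refl
∑-cong (suc n) f≡g = cong₂ _+_ (f≡g zero) (∑-cong n (f≡g ∘ suc))

term≤∑ : ∀ n (f : Fin n → ℕ) i → f i ≤ ∑ n f
term≤∑ (suc n) f zero    = m≤m+n (f zero) _
term≤∑ (suc n) f (suc i) = ≤-trans (term≤∑ n (f ∘ suc) i) (m≤n+m _ (f zero))

count≤ : ∀ n (p : Fin n → Bool) → count n p ≤ n
count≤ zero    p = z≤n
count≤ (suc n) p with p zero
... | true  = s≤s (count≤ n (p ∘ suc))
... | false = m≤n⇒m≤1+n (count≤ n (p ∘ suc))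

∑-average : ∀ n k (f : Fin n → ℕ) → n * k <ℕ ∑ n f → ∃[ i ] k <ℕ f i
∑-average (suc n) k f lt with ≤-<-connex (f zero) k
... | inj₂ k<f0 = zero , k<f0
... | inj₁ f0≤k with i , k<fi ← ∑-average n k (f ∘ suc)
        (+-cancelˡ-< k _ _ (<-≤-trans lt (+-monoˡ-≤ _ f0≤k))) = suc i , k<fi

count-overlap : ∀ n (p q : Fin n → Bool) → n <ℕ count n p + count n q →
  ∃[ i ] (p i ≡ true × q i ≡ true)
count-overlap n p q lt
  with i , 1<pi+qi ← ∑-average n 1 (λ i → 𝟙 (p i) + 𝟙 (q i))
         (subst₂ _<ℕ_ (sym (*-identityʳ n)) (sym (∑-+ n (𝟙 ∘ p) (𝟙 ∘ q))) lt)
  = i , both (p i) (q i) 1<pi+qi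
  where
  both : ∀ a b → 1 <ℕ 𝟙 a + 𝟙 b → a ≡ true × b ≡ true
  both true  true  _        = refl , refl
  both true  false (s≤s ())
  both false true  (s≤s ())

module _ {E : Set} {n K : ℕ} {P : Fin n → Fin K → E → Set} (P? : ∀ x c e → Dec (P x c e))
         (p : E → Fin n → Bool) (colour : ∀ e x → p e x ≡ true → ∃[ c ] P x c e) where

  𝟙≤∑-colours : ∀ e x → 𝟙 (p e x) ≤ ∑ K (λ c → 𝟙 (does (P? x c e)))
  𝟙≤∑-colours e x with p e x in px
  ... | false = z≤n
  ... | true with c , Pxce ← colour e x px =
    subst (_≤ ∑ K (λ c → 𝟙 (does (P? x c e)))) (cong 𝟙 (dec-true (P? x c e) Pxce))
      (term≤∑ K (λ c → 𝟙 (does (P? x c e))) c)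

  length-filter-∷ : ∀ x c e es →
    length (filter (P? x c) (e ∷ es)) ≡ 𝟙 (does (P? x c e)) + length (filter (P? x c) es)
  length-filter-∷ x c e es with does (P? x c e)
  ... | true  = refl
  ... | false = refl

  -- Counts the incidences (e , x) by e and by x. A pair with several admissible colours is counted
  -- more than once on the right, which only helps.
  double-count : ∀ q w es → All (λ e → w ≤ q * count n (p e)) es →
    w * length es ≤ q * ∑ n (λ x → ∑ K (λ c → length (filter (P? x c) es)))
  double-count q w []       []           = ≤-trans (≤-reflexive (*-zeroʳ w)) z≤n
  double-count q w (e ∷ es) (w≤ ∷ w≤s) = begin
    w * suc (length es)                     ≡⟨ *-suc w (length es) ⟩
    w + w * length es                       ≤⟨ +-mono-≤ w≤ (double-count q w es w≤s) ⟩
    q * count n (p e) + q * ∑ n (λ x → ∑ K (λ c → L x c))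
      ≤⟨ +-monoˡ-≤ _ (*-monoʳ-≤ q (∑-mono n (𝟙≤∑-colours e))) ⟩
    q * ∑ n (λ x → ∑ K (λ c → I x c)) + q * ∑ n (λ x → ∑ K (λ c → L x c))
      ≡⟨ *-distribˡ-+ q (∑ n (λ x → ∑ K (λ c → I x c))) _ ⟨
    q * (∑ n (λ x → ∑ K (λ c → I x c)) + ∑ n (λ x → ∑ K (λ c → L x c)))
      ≡⟨ cong (q *_) (∑-+ n _ _) ⟨
    q * ∑ n (λ x → ∑ K (λ c → I x c) + ∑ K (λ c → L x c))
      ≡⟨ cong (q *_) (∑-cong n (λ x → trans (∑-cong K (λ c → length-filter-∷ x c e es)) (∑-+ K (I x) (L x)))) ⟨
    q * ∑ n (λ x → ∑ K (λ c → length (filter (P? x c) (e ∷ es)))) ∎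
    where
    open ≤-Reasoning
    I L : Fin n → Fin K → ℕ
    I x c = 𝟙 (does (P? x c e))
    L x c = length (filter (P? x c) es)

  -- Pigeonhole over the `n * K` pairs (x , c). It serves twice: with e a class and x a vertex of
  -- V_k, and with e a pick and x a vertex of V_i.
  popular-pair : ∀ q w s es → All (λ e → w ≤ q * count n (p e)) es →
    q * (n * (K * s)) <ℕ w * length es → ∃[ x ] ∃[ c ] s <ℕ length (filter (P? x c) es)
  popular-pair q w s es w≤ lt
    with x , ltx ← ∑-average n (K * s) _ (*-cancelˡ-< q _ _ (<-≤-trans lt (double-count q w es w≤)))
    with c , ltc ← ∑-average K s _ ltx = x , c , ltc

first-two : ∀ {E : Set} {P : E → Set} {R : E → E → Set} xs → All P xs → AllPairs R xs →
  1 <ℕ length xs → ∃[ x ] ∃[ y ] (P x × P y × R x y)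
first-two (x ∷ y ∷ _) (px ∷ py ∷ _) ((xRy ∷ _) ∷ _) _ = x , y , px , py , xRy
first-two (_ ∷ []) _ _ (s≤s ())

-- Heavy vertices have many neighbours of large degree

4mn≤[m+n]² : ∀ m n → 4 * (m * n) ≤ (m + n) * (m + n)
4mn≤[m+n]² m n with ≤-total m n
... | inj₁ m≤n with d , refl ← m≤n⇒∃[o]m+o≡n m≤n =
  subst (4 * (m * (m + d)) ≤_) (eq m d) (m≤m+n _ (d * d))
  where
  eq : ∀ m d → 4 * (m * (m + d)) + d * d ≡ (m + (m + d)) * (m + (m + d))
  eq = solve-∀
... | inj₂ n≤m with d , refl ← m≤n⇒∃[o]m+o≡n n≤m =
  subst (4 * ((n + d) * n) ≤_) (eq n d) (m≤m+n _ (d * d))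
  where
  eq : ∀ n d → 4 * ((n + d) * n) + d * d ≡ (n + d + n) * (n + d + n)
  eq = solve-∀

degY : (a b : ℕ) → (Fin a → Fin b → Bool) → Fin b → ℕ
degY a b e y = count a (λ x → e x y)

module _ (a b : ℕ) (e : Fin a → Fin b → Bool) (N : ℕ) (y : Fin b) where

  -- Neighbours x of y with deg(x) / b > 1 − c / N.
  richNbr : ℕ → Fin a → Bool
  richNbr c x = e x y ∧ does (N * b <? N * degX a b e x + c * b)

  module _ (c r : ℕ) (c+r≡N : c + r ≡ N) where

    -- `r` is N - c, written without truncated subtraction. Any degree is at most b, and a degree
    -- failing the test is at most (r / N) b.
    richNbr-bound : ∀ x (rich? : Dec (N * b <ℕ N * degX a b e x + c * b)) →
      N * degX a b e x ≤ N * b * 𝟙 (does rich?) + r * b * 1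
    richNbr-bound x (yes _) = ≤-trans (*-monoʳ-≤ N (count≤ b (e x)))
      (≤-trans (≤-reflexive (sym (*-identityʳ (N * b)))) (m≤m+n _ _))
    richNbr-bound x (no ≮) = begin
      N * degX a b e x       ≤⟨ +-cancelʳ-≤ (c * b) _ _ (≤-trans (≮⇒≥ ≮) (≤-reflexive Nb)) ⟩
      r * b                  ≡⟨ *-identityʳ (r * b) ⟨
      r * b * 1              ≤⟨ m≤n+m _ _ ⟩
      N * b * 0 + r * b * 1  ∎
      where
      open ≤-Reasoning
      Nb : N * b ≡ r * b + c * b
      Nb = trans (cong (_* b) (trans (sym c+r≡N) (+-comm c r))) (*-distribʳ-+ b r c)

    walk-bound : ∀ x → N * (if e x y then degX a b e x else 0)
                     ≤ N * b * 𝟙 (richNbr c x) + r * b * 𝟙 (e x y)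
    walk-bound x with e x y
    ... | false = ≤-trans (≤-reflexive (*-zeroʳ N)) z≤n
    ... | true  = richNbr-bound x (N * b <? N * degX a b e x + c * b)

    walks2-bound : N * walks2 a b e y ≤ N * b * count a (richNbr c) + r * b * degY a b e y
    walks2-bound = begin
      N * walks2 a b e y   ≡⟨ ∑-* a N _ ⟨
      ∑ a _                ≤⟨ ∑-mono a walk-bound ⟩
      ∑ a _                ≡⟨ ∑-+ a _ _ ⟩
      ∑ a _ + ∑ a _        ≡⟨ cong₂ _+_ (∑-* a (N * b) (𝟙 ∘ richNbr c)) (∑-* a (r * b) (λ x → 𝟙 (e x y))) ⟩
      N * b * count a (richNbr c) + r * b * degY a b e y ∎
      where open ≤-Reasoning

    many-richNbrs : ∀ q .{{_ : NonZero N}} → N ≡ 2 * q →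
      (q + 4) * (a * b) <ℕ 4 * q * walks2 a b e y → N * degY a b e y ≤ suc c * a →
      a <ℕ N * count a (richNbr c)
    -- Heaviness exceeds 1/4 by 1/q = 2/N. Rounding the level up to c + 1 costs at most 1/N, and the
    -- remaining 1/N must come from D. All is scaled by 4N.
    many-richNbrs q N≡2q walks deg = *-cancelˡ-< (4 * N * b) _ _ (+-cancelʳ-< ((N * N + 4 * N) * (a * b)) _ _ (begin-strict
      4 * N * b * a + (N * N + 4 * N) * (a * b)   ≡⟨ eq₁ N a b ⟩
      N * ((N + 8) * (a * b))                     ≡⟨ cong (λ M → N * ((M + 8) * (a * b))) N≡2q ⟩
      N * ((2 * q + 8) * (a * b))                 ≡⟨ eq₂ N q a b ⟩
      2 * N * ((q + 4) * (a * b))                 <⟨ *-monoʳ-< (2 * N) {{m*n≢0 2 N}} walks ⟩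
      2 * N * (4 * q * W)                         ≡⟨ eq₃ N q W ⟩
      4 * (2 * q) * (N * W)                       ≡⟨ cong (λ M → 4 * M * (N * W)) N≡2q ⟨
      4 * N * (N * W)                             ≤⟨ *-monoʳ-≤ (4 * N) walks2-bound ⟩
      4 * N * (N * b * D + r * b * dY)          ≡⟨ eq₄ N b D r dY ⟩
      4 * N * b * (N * D) + 4 * r * b * (N * dY) ≤⟨ +-monoʳ-≤ (4 * N * b * (N * D)) (begin
          4 * r * b * (N * dY)                  ≤⟨ *-monoʳ-≤ (4 * r * b) deg ⟩
          4 * r * b * (suc c * a)                 ≡⟨ eq₅ r b c a ⟩
          -- AM-GM bounds the product of c and N - c; the term `4 * r` is the cost of rounding.
          (4 * (c * r) + 4 * r) * (a * b)         ≤⟨ *-monoˡ-≤ (a * b) (+-mono-≤ (4mn≤[m+n]² c r) (*-monoʳ-≤ 4 (m≤n+m r c))) ⟩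
          ((c + r) * (c + r) + 4 * (c + r)) * (a * b) ≡⟨ cong (λ M → (M * M + 4 * M) * (a * b)) c+r≡N ⟩
          (N * N + 4 * N) * (a * b)               ∎) ⟩
      4 * N * b * (N * D) + (N * N + 4 * N) * (a * b) ∎))
      where
      open ≤-Reasoning
      dY = degY a b e y
      W = walks2 a b e y
      D = count a (richNbr c)
      eq₁ : ∀ N a b → 4 * N * b * a + (N * N + 4 * N) * (a * b) ≡ N * ((N + 8) * (a * b))
      eq₁ = solve-∀
      eq₂ : ∀ N q a b → N * ((2 * q + 8) * (a * b)) ≡ 2 * N * ((q + 4) * (a * b))
      eq₂ = solve-∀
      eq₃ : ∀ N q W → 2 * N * (4 * q * W) ≡ 4 * (2 * q) * (N * W)
      eq₃ = solve-∀
      eq₄ : ∀ N b D r A → 4 * N * (N * b * D + r * b * A) ≡ 4 * N * b * (N * D) + 4 * r * b * (N * A)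
      eq₄ = solve-∀
      eq₅ : ∀ r b c a → 4 * r * b * (suc c * a) ≡ (4 * (c * r) + 4 * r) * (a * b)
      eq₅ = solve-∀

-- The greedy choice

-- Each round spends one class on the pick and divides the remaining list by C. As lengths must
-- exceed it strictly, the value 0 still leaves the final class.
threshold : ℕ → ℕ → ℕ
threshold C zero    = 0
threshold C (suc t) = suc (C * threshold C t)

module _ {V E : Set} (class : E → V) {Good : E → V → Set} (Good? : ∀ e i → Dec (Good e i))
         {_≻_ : V → V → Set} (C : ℕ)
         (choose : ∀ k s I → All (k ≻_) I → C * s <ℕ length I →
           ∃[ e ] (class e ≡ k × s <ℕ length (filter (Good? e) I))) where

  -- Q carries the goodness towards earlier picks through the recursion of greedy.
  Chain : ℕ → (V → Set) → Set
  Chain t Q = ∃[ es ] ∃[ i ] (length es ≡ t × AllPairs (λ e e′ → Good e (class e′)) es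
    × All (λ e → Good e i) es × All (Q ∘ class) es × Q i)

  extend : ∀ {t Q} e → Q (class e) → Chain t (λ i → Good e i × Q i) → Chain (suc t) Q
  extend e Qe (es , i , len , pairs , good , QGood , gi , Qi) =
    e ∷ es , i , cong suc len , All.map proj₁ QGood ∷ pairs , gi ∷ good , Qe ∷ All.map proj₂ QGood , Qi

  -- Recursing inside the classes towards which e is good makes all later picks good for e;
  -- filtering preserves the order that `choose` relies on.
  greedy : ∀ t {Q} I → AllPairs _≻_ I → All Q I → threshold C t <ℕ length I → Chain t Q
  greedy zero    (i ∷ I) _            (Qi ∷ _)  _        = [] , i , refl , [] , [] , [] , Qi
  greedy (suc t) (k ∷ I) (k≻I ∷ desc) (Qk ∷ QI) (s≤s lt)
    with e , refl , ltJ ← choose k (threshold C t) I k≻I lt =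
    extend e Qk (greedy t (filter (Good? e) I) (AllPairs.filter⁺ (Good? e) desc)
      (All.zip (All.all-filter (Good? e) I , All.filter⁺ (Good? e) QI)) ltJ)

opposite-antitone : ∀ {m} {i j : Fin m} → i < j → opposite j < opposite i
opposite-antitone {m} {i} {j} i<j =
  subst₂ _<ℕ_ (sym (opposite-prop j)) (sym (opposite-prop i)) (∸-monoʳ-< (s≤s i<j) (toℕ<n j))

-- Picks in the graph and the triangle

module _ (q : ℕ) {{q≢0 : NonZero q}} {m : ℕ} {n : Fin m → ℕ} (n≢0 : ∀ i → NonZero (n i))
         (G : MPartiteGraph m n) (hvy : ∀ i k → Fin (n k) → Bool)
         (hvy-many : ∀ i k → i < k → n k ≤ q * count (n k) (hvy i k))
         (hvy-walks : ∀ i k y → hvy i k y ≡ true →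
           (q + 4) * (n i * n k) <ℕ 4 * q * walks2 (n i) (n k) (bip G i k) y) where

  N K : ℕ
  N = 2 * q
  -- Levels run from 0 to N inclusive, since y may be adjacent to all of V_i.
  K = suc N

  N-nonZero : NonZero N
  N-nonZero = m*n≢0 2 q

  record Pick : Set where
    constructor pick
    field
      class  : Fin m
      vertex : Fin (n class)
      level  : Fin K

  open Pick

  -- The vertex is heavy towards V_i, with neighbourhood of relative size in [c/N , (c+1)/N].
  Good : Pick → Fin m → Set
  Good (pick k y c) i = hvy i k y ≡ true
    × toℕ c * n i ≤ N * degY (n i) (n k) (bip G i k) y
    × N * degY (n i) (n k) (bip G i k) y ≤ suc (toℕ c) * n i

  Good? : ∀ e i → Dec (Good e i)
  Good? (pick k y c) i = (_ Bool.≟ true) ×-dec (_ ≤? _) ×-dec (_ ≤? _)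

  -- The level is the integer part of N |N_i(y)| / |V_i|.
  hvy⇒Good : ∀ k i y → hvy i k y ≡ true → ∃[ c ] Good (pick k y c) i
  hvy⇒Good k i y hv = fromℕ< c<K , hv
    , subst (λ c → c * n i ≤ d) (sym (toℕ-fromℕ< c<K)) (m/n*n≤m d (n i))
    , subst (λ c → d ≤ suc c * n i) (sym (toℕ-fromℕ< c<K))
        (subst (_≤ suc (d / n i) * n i) (sym (m≡m%n+[m/n]*n d (n i)))
          (+-monoˡ-≤ (d / n i * n i) (<⇒≤ (m%n<n d (n i)))))
    where
    instance _ = n≢0 i
    d = N * degY (n i) (n k) (bip G i k) y
    c<K : d / n i <ℕ K
    c<K = m<n*o⇒m/o<n (≤-<-trans (*-monoʳ-≤ N (count≤ (n i) _)) (*-monoˡ-< (n i) (n<1+n N)))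

  -- Of the lost factor `q * K`, richness accounts for `q` and the choice of a level for `K`.
  choose : ∀ k s I → All (_< k) I → q * K * s <ℕ length I →
    ∃[ e ] (class e ≡ k × s <ℕ length (filter (Good? e) I))
  choose k s I I<k lt =
    let y , c , ltJ = popular-pair {Fin m} {n k} {K}
          (λ y c → Good? (pick k y c)) (λ i → hvy i k) (hvy⇒Good k)
          q (n k) s I (All.map (λ {i} → hvy-many i k) I<k)
          (subst (_<ℕ n k * length I) (rearrange (n k) q K s) (*-monoʳ-< (n k) {{n≢0 k}} lt))
    in pick k y c , refl , ltJ
    where
    rearrange : ∀ a q K s → a * (q * K * s) ≡ q * (a * (K * s))
    rearrange = solve-∀

  module _ (i : Fin m) where

    richAt : Pick → Fin (n i) → Bool
    richAt (pick k y c) = richNbr (n i) (n k) (bip G i k) N y (toℕ c)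

    many-richAt : ∀ e → Good e i → n i <ℕ N * count (n i) (richAt e)
    many-richAt (pick k y c) (hv , _ , deg)
      with r , c+r≡N ← m≤n⇒∃[o]m+o≡n (≤-pred (toℕ<n c)) =
      many-richNbrs (n i) (n k) (bip G i k) N y (toℕ c) r c+r≡N q {{N-nonZero}} refl
        (hvy-walks i k y hv) deg

    ∧-true : ∀ {a b} → a ∧ b ≡ true → a ≡ true × b ≡ true
    ∧-true {true} {true} refl = refl , refl

    triangle : ∀ e e′ x → richAt e x ≡ true → richAt e′ x ≡ true → level e ≡ level e′ →
      Good e (class e′) → HasTriangle G
    triangle (pick k y c) (pick j y′ .c) x xe xe′ refl (_ , cn≤ , _)
      -- `xe′` gives N deg_j(x) > (N - c) |V_j|, and goodness of the earlier pick towards V_j gives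
      -- N |N_j(y)| ≥ c |V_j|; the two neighbourhoods overlap in z.
      with z , xz , zy ← count-overlap (n j) (adj G i x j) (λ z → adj G j z k y)
        (*-cancelˡ-< N _ _ (<-≤-trans
          (does-true (_ <? _) (proj₂ (∧-true {adj G i x j y′} xe′)))
          (≤-trans (+-monoʳ-≤ _ cn≤) (≤-reflexive (sym (*-distribˡ-+ N _ _))))))
      = i , x , j , z , k , y , xz , zy , proj₁ (∧-true {adj G i x k y} xe)

    RichAtLevel? : ∀ x c e → Dec (richAt e x ≡ true × level e ≡ c)
    RichAtLevel? x c e = (_ Bool.≟ true) ×-dec (level e ≟F c)

    -- Each of the `N * K` sets D has at least (a + 1) / N elements, so the average over the `a * K`
    -- pairs (x , level) exceeds 1.
    enough-picks : ∀ a → N * (a * (K * 1)) <ℕ suc a * (N * K)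
    enough-picks a = subst (_<ℕ suc a * (N * K)) (rearrange a N K)
      (*-monoˡ-< (N * K) {{m*n≢0 N K {{N-nonZero}}}} (n<1+n a))
      where
      rearrange : ∀ a N K → a * (N * K) ≡ N * (a * (K * 1))
      rearrange = solve-∀

    two-picks : ∀ es → length es ≡ N * K → AllPairs (λ e e′ → Good e (class e′)) es →
      All (λ e → Good e i) es → HasTriangle G
    two-picks es len pairs good =
      let x , c , lt = popular-pair {Pick} {n i} {K} RichAtLevel? richAt (λ e x xe → level e , xe , refl)
            N (suc (n i)) 1 es (All.map (λ {e} → many-richAt e) good)
            (subst (λ L → N * (n i * (K * 1)) <ℕ suc (n i) * L) (sym len) (enough-picks (n i)))
          e , e′ , (xe , ce) , (xe′ , ce′) , g = first-two (filter (RichAtLevel? x c) es)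
            (All.all-filter (RichAtLevel? x c) es) (AllPairs.filter⁺ (RichAtLevel? x c) pairs) lt
      in triangle e e′ x xe xe′ (trans ce (sym ce′)) g

  chain⇒triangle : threshold (q * K) (N * K) <ℕ m → HasTriangle G
  chain⇒triangle lt =
    let es , i , len , pairs , good , _ = greedy class Good? {λ k i → i < k} (q * K) choose (N * K)
          -- Classes are listed from the largest index down: richness of (V_i , V_k) with i < k puts
          -- the heavy vertices in V_k, so each pick must precede its targets.
          {λ _ → ⊤} (tabulate opposite) (AllPairs.tabulate⁺-< opposite-antitone) (All.universal _ _)
          (subst (threshold (q * K) (N * K) <ℕ_) (sym (length-tabulate opposite)) lt)
    in two-picks i es len pairs good

theorem5p3 : (ξ : ℚ) → 0ℚ <ℚ ξ →
    ∃[ m₀ ] ((m : ℕ) → m₀ ≤ m →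
    (n : Fin m → ℕ) → ((i : Fin m) → NonZero (n i)) →
    (G : MPartiteGraph m n) →
    ((i j : Fin m) → i < j → Rich ξ (n i) (n j) (bip G i j)) →
    HasTriangle G)
theorem5p3 ξ ξ>0 = suc (threshold (q * suc (2 * q)) (2 * q * suc (2 * q))) , λ m m₀≤m n n≢0 G rich →
  chain⇒triangle q n≢0 G (λ i k → heavy ξ (n i) (n k) (bip G i k))
    (λ i k i<k → <⇒≤ (Rich⇒count ξ ξ>0 (n i) (n k) (bip G i k) (rich i k i<k)))
    (λ i k → heavy⇒walks2 ξ ξ>0 (n i) (n k) (bip G i k))
    m₀≤m
  where q = ↧ₙ ξ
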